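{- The formal power series $I(b,\ell;r)$ and $J(b;r)$ satisfy, for integers $b$ and $\ell$: (i) $I(b,1;r)=(1+r)^{b+1}\frac{\partial}{\partial r}\big((1+r)^{ -b}J(b;r)\big)$ for $b\geq0$; (ii) $I(b,1;r)-I(b,0;r)=J(b;r)$ for $b\geq0$; (iii) $(1+r)^{b+1}\frac{\partial}{\partial r}\big((1+r)^{ -b}I(b,\ell;r)\big)=-\ell\,I(b,\ell;r)+\sum_{k=1}^\ell2k\,I(b,k;r)-\sum_{k=1}^b2k\,I(b,k;r)$ for $\ell,b\geq0$.
   Context: The formal power series in $r$ are defined by $$I(b,\ell;r)=\sum_{p=0}^\infty\frac{r^p}{(p!)^2}\prod_{m=0}^{p-1}(\ell^2-(b-m)^2),\qquad J(b;r)=\sum_{p=1}^\infty\frac{(-1)^{p+1}r^p}{p!(p-1)!}\prod_{m=0}^{p-2}(b-m)(b-m-1).$$ -}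

module Defs where

open import Algebra.Bundles using (RawSemiring)
open import Data.Fin.Base using (Fin; toℕ)
open import Data.Integer.Base as ℤ using (ℤ; +_; -[1+_]; 1ℤ; -1ℤ)
open import Data.Nat.Base as ℕ using (ℕ; zero; suc; _∸_; _!)
open import Data.Nat.Properties using (_!*_!≢0)
open import Data.Rational.Base as ℚ using (ℚ; 0ℚ; 1ℚ; _/_)
import Data.Rational.Properties as ℚ
open import Level using (0ℓ)
open import Relation.Binary.PropositionalEquality using (_≡_; refl; sym; trans; cong; cong₂; module ≡-Reasoning)
import Algebra.Definitions.RawSemiring as RawSemiringDefinitions
import Algebra.Properties.Monoid.Sum ℚ.+-0-monoid as ℚΣ

-- An element of ℚ[[r]] is its sequence of coefficients; equality is coefficientwise.

PowerSeries : Set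
PowerSeries = ℕ → ℚ

infix  4 _≈_
infixl 6 _+_ _-_
infixl 7 _*_
infixr 7 _·_

_≈_ : PowerSeries → PowerSeries → Set
f ≈ g = ∀ n → f n ≡ g n

0# 1# r : PowerSeries
0# _ = 0ℚ
1# zero    = 1ℚ
1# (suc _) = 0ℚ
r (suc zero) = 1ℚ
r _          = 0ℚ

_+_ _-_ _*_ : PowerSeries → PowerSeries → PowerSeries
(f + g) n = f n ℚ.+ g n
(f - g) n = f n ℚ.- g n
(f * g) n = ℚΣ.sum {suc n} λ i → f (toℕ i) ℚ.* g (n ∸ toℕ i)

_·_ : ℤ → PowerSeries → PowerSeries
(c · f) n = (c / 1) ℚ.* f n

∂/∂r : PowerSeries → PowerSeries
∂/∂r f n = (+ suc n / 1) ℚ.* f (suc n)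

powerSeriesRawSemiring : RawSemiring 0ℓ 0ℓ
powerSeriesRawSemiring = record
  { Carrier = PowerSeries ; _≈_ = _≈_ ; _+_ = _+_ ; _*_ = _*_ ; 0# = 0# ; 1# = 1# }

open RawSemiringDefinitions powerSeriesRawSemiring using (sum; _^_)

sum₁ : ℕ → (ℕ → PowerSeries) → PowerSeries
sum₁ n f = sum {n} λ i → f (suc (toℕ i))

infixl 6 sum₁
syntax sum₁ n (λ k → f) = ∑[ 1≤ k ≤ n ] f

1+r : PowerSeries
1+r = 1# + r

[1+r]⁻¹ : PowerSeries
[1+r]⁻¹ n = (-1ℤ ℤ.^ n) / 1

[1+r]-inverseʳ : 1+r * [1+r]⁻¹ ≈ 1#
[1+r]-inverseʳ zero    = refl
[1+r]-inverseʳ (suc n) = begin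
  1ℚ ℚ.* a (suc n) ℚ.+ (1ℚ ℚ.* a n ℚ.+ rest)
    ≡⟨ cong₂ (λ x y → 1ℚ ℚ.* a (suc n) ℚ.+ (x ℚ.+ y)) (ℚ.*-identityˡ (a n)) rest≡0 ⟩
  1ℚ ℚ.* a (suc n) ℚ.+ (a n ℚ.+ 0ℚ)
    ≡⟨ cong₂ ℚ._+_ (trans (ℚ.*-identityˡ (a (suc n))) (step n)) (ℚ.+-identityʳ (a n)) ⟩
  ℚ.- a n ℚ.+ a n
    ≡⟨ ℚ.+-inverseˡ (a n) ⟩
  0ℚ ∎
  where
  open ≡-Reasoning
  open import Data.Integer.Properties using (-1*i≡-i)

  a = [1+r]⁻¹

  neg-/1 : ∀ i → (ℤ.- i) / 1 ≡ ℚ.- (i / 1)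
  neg-/1 (+ zero)  = refl
  neg-/1 (+ suc _) = refl
  neg-/1 -[1+ m ]  = sym (⁻¹-involutive (+ suc m / 1))
    where open import Algebra.Properties.Group ℚ.+-0-group using (⁻¹-involutive)

  step : ∀ m → a (suc m) ≡ ℚ.- a m
  step m = trans (cong (_/ 1) (-1*i≡-i (-1ℤ ℤ.^ m))) (neg-/1 (-1ℤ ℤ.^ m))

  g : Fin n → ℚ
  g i = 0ℚ ℚ.* a (suc n ∸ suc (suc (toℕ i)))

  rest = ℚΣ.sum g

  rest≡0 : rest ≡ 0ℚ
  rest≡0 = trans (ℚΣ.sum-cong-≗ {n} {g} {λ _ → 0ℚ} (λ i → ℚ.*-zeroˡ (a (suc n ∸ suc (suc (toℕ i))))))
                 (ℚΣ.sum-replicate-zero n)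

infixr 8 [1+r]^_

[1+r]^_ : ℤ → PowerSeries
[1+r]^ (+ n)    = 1+r ^ n
[1+r]^ -[1+ n ] = [1+r]⁻¹ ^ suc n

∏ : ℕ → (ℕ → ℤ) → ℤ
∏ n f = product {n} λ i → f (toℕ i)
  where open RawSemiringDefinitions ℤ.+-*-rawSemiring using (product)

infixl 7 ∏
syntax ∏ n (λ m → x) = ∏[ m < n ] x

I : ℤ → ℤ → PowerSeries
I b ℓ p = (∏[ m < p ] (ℓ ℤ.^ 2 ℤ.- (b ℤ.- + m) ℤ.^ 2)) / (p ! ℕ.* p !)
  where instance _ = p !* p !≢0

-- The series starts at p = 1; the clause below is the coefficient at p = suc q.
J : ℤ → PowerSeries
J b zero      = 0ℚ
J b p@(suc q) =
  (-1ℤ ℤ.^ (p ℕ.+ 1) ℤ.* (∏[ m < q ] ((b ℤ.- + m) ℤ.* (b ℤ.- + m ℤ.- 1ℤ)))) / (p ! ℕ.* q !)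
  where instance _ = p !* q !≢0

-- With F = (1 + r)ᵇ G, the Leibniz rule for multiplication by 1 + r gives
-- (1 + r)ᵇ⁺¹ ∂G/∂r = (1 + r) ∂F/∂r − b F, whose n-th coefficient is (n + 1) Fₙ₊₁ + (n − b) Fₙ.
-- All three identities then become identities between coefficients. In (iii), this coefficient for
-- F = I(b,ℓ), plus that of ℓ I(b,ℓ), equals (ℓ − b + n)(ℓ + b + 1) / (n + 1) times that of I(b,ℓ);
-- this quantity grows by 2ℓ I(b,ℓ)ₙ from ℓ − 1 to ℓ and vanishes at ℓ = b, so it is the
-- difference of the two sums.

module Submission where

open import Defs
open import Algebra.Definitions.RawSemiring powerSeriesRawSemiring using (_^_)
open import Data.Fin.Base using (Fin; zero; suc; toℕ)
open import Data.Integer.Base as ℤ using (ℤ; +_; 0ℤ; 1ℤ; -1ℤ)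
open import Data.Integer.Properties as ℤ using (pos-*)
open import Data.Integer.Tactic.RingSolver using (solve-∀)
open import Data.Nat.Base as ℕ using (ℕ; zero; suc; _∸_; _!; NonZero)
open import Data.Nat.Properties as ℕ using (_!*_!≢0)
open import Data.Product.Base using (_×_; _,_)
open import Data.Rational.Base as ℚ using (ℚ; 0ℚ; 1ℚ; _/_; fromℚᵘ)
open import Data.Rational.Properties as ℚ using (fromℚᵘ-cong; toℚᵘ-injective; toℚᵘ-fromℚᵘ; toℚᵘ-homo-+; toℚᵘ-homo-*)
open import Data.Rational.Solver using (module +-*-Solver)
open import Data.Rational.Unnormalised.Base as ℚᵘ using (mkℚᵘ; *≡*)
import Data.Rational.Unnormalised.Properties as ℚᵘ
open import Relation.Binary.PropositionalEquality
  using (_≡_; refl; sym; trans; cong; cong₂; module ≡-Reasoning)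
import Algebra.Properties.CommutativeMonoid.Sum ℚ.+-0-commutativeMonoid as ℚΣ

open ≡-Reasoning

-- Fractions

fromℚᵘ-homo-+ : ∀ p q → fromℚᵘ p ℚ.+ fromℚᵘ q ≡ fromℚᵘ (p ℚᵘ.+ q)
fromℚᵘ-homo-+ p q = toℚᵘ-injective (ℚᵘ.≃-trans (toℚᵘ-homo-+ (fromℚᵘ p) (fromℚᵘ q))
  (ℚᵘ.≃-trans (ℚᵘ.+-cong (toℚᵘ-fromℚᵘ p) (toℚᵘ-fromℚᵘ q)) (ℚᵘ.≃-sym (toℚᵘ-fromℚᵘ (p ℚᵘ.+ q)))))

fromℚᵘ-homo-* : ∀ p q → fromℚᵘ p ℚ.* fromℚᵘ q ≡ fromℚᵘ (p ℚᵘ.* q)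
fromℚᵘ-homo-* p q = toℚᵘ-injective (ℚᵘ.≃-trans (toℚᵘ-homo-* (fromℚᵘ p) (fromℚᵘ q))
  (ℚᵘ.≃-trans (ℚᵘ.*-cong (toℚᵘ-fromℚᵘ p) (toℚᵘ-fromℚᵘ q)) (ℚᵘ.≃-sym (toℚᵘ-fromℚᵘ (p ℚᵘ.* q)))))

/-cross : ∀ i j m n .{{_ : NonZero m}} .{{_ : NonZero n}} →
          i ℤ.* + n ≡ j ℤ.* + m → i / m ≡ j / n
/-cross i j (suc m) (suc n) eq = fromℚᵘ-cong {mkℚᵘ i m} {mkℚᵘ j n} (*≡* eq)

/-homo-+ : ∀ i j d .{{_ : NonZero d}} → (i / d) ℚ.+ (j / d) ≡ (i ℤ.+ j) / d
/-homo-+ i j (suc d) = trans (fromℚᵘ-homo-+ (mkℚᵘ i d) (mkℚᵘ j d))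
  (fromℚᵘ-cong {mkℚᵘ i d ℚᵘ.+ mkℚᵘ j d} {mkℚᵘ (i ℤ.+ j) d} (*≡* (begin
    (i ℤ.* + suc d ℤ.+ j ℤ.* + suc d) ℤ.* + suc d  ≡⟨ cancel i j (+ suc d) ⟩
    (i ℤ.+ j) ℤ.* (+ suc d ℤ.* + suc d)            ≡⟨ cong ((i ℤ.+ j) ℤ.*_) (pos-* (suc d) (suc d)) ⟨
    (i ℤ.+ j) ℤ.* + (suc d ℕ.* suc d)              ∎)))
  where
  cancel : ∀ i j d → (i ℤ.* d ℤ.+ j ℤ.* d) ℤ.* d ≡ (i ℤ.+ j) ℤ.* (d ℤ.* d)
  cancel = solve-∀

/1-*-/ : ∀ i j d .{{_ : NonZero d}} → (i / 1) ℚ.* (j / d) ≡ (i ℤ.* j) / d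
/1-*-/ i j (suc d) = trans (fromℚᵘ-homo-* (mkℚᵘ i 0) (mkℚᵘ j d))
  (fromℚᵘ-cong {mkℚᵘ i 0 ℚᵘ.* mkℚᵘ j d} {mkℚᵘ (i ℤ.* j) d}
    (*≡* (cong (λ n → i ℤ.* j ℤ.* + n) (sym (ℕ.*-identityˡ (suc d))))))

/-homo-- : ∀ i j d .{{_ : NonZero d}} → (i / d) ℚ.- (j / d) ≡ (i ℤ.- j) / d
/-homo-- i j d = begin
  (i / d) ℚ.- (j / d)                             ≡⟨ cong (λ k → (k / d) ℚ.- (j / d)) (split i j) ⟨
  (i ℤ.- j ℤ.+ j) / d ℚ.- (j / d)                 ≡⟨ cong (ℚ._- (j / d)) (/-homo-+ (i ℤ.- j) j d) ⟨
  ((i ℤ.- j) / d) ℚ.+ (j / d) ℚ.- (j / d)         ≡⟨ solve 2 (λ x y → x :+ y :- y := x) refl ((i ℤ.- j) / d) (j / d) ⟩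
  (i ℤ.- j) / d                                   ∎
  where
  open +-*-Solver
  split : ∀ i j → i ℤ.- j ℤ.+ j ≡ i
  split = solve-∀

-- Multiplication by powers of 1 + r

≈-trans : ∀ {f g h} → f ≈ g → g ≈ h → f ≈ h
≈-trans p q n = trans (p n) (q n)

≈-sym : ∀ {f g} → f ≈ g → g ≈ f
≈-sym p n = sym (p n)

*-congˡ : ∀ f {g h} → g ≈ h → f * g ≈ f * h
*-congˡ f p n = ℚΣ.sum-cong-≗ {suc n} λ i → cong (f (toℕ i) ℚ.*_) (p (n ∸ toℕ i))

*-congʳ : ∀ {f g} h → f ≈ g → f * h ≈ g * h
*-congʳ h p n = ℚΣ.sum-cong-≗ {suc n} λ i → cong (ℚ._* h (n ∸ toℕ i)) (p (toℕ i))

sum-0*≡0 : ∀ n (f : Fin n → ℚ) → ℚΣ.sum (λ i → 0ℚ ℚ.* f i) ≡ 0ℚ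
sum-0*≡0 n f = trans (ℚΣ.sum-cong-≗ {n} λ i → ℚ.*-zeroˡ (f i)) (ℚΣ.sum-replicate-zero n)

*-identityˡ : ∀ f → 1# * f ≈ f
*-identityˡ f n = begin
  1ℚ ℚ.* f n ℚ.+ ℚΣ.sum {n} (λ i → 0ℚ ℚ.* f (n ∸ suc (toℕ i)))
    ≡⟨ cong₂ ℚ._+_ (ℚ.*-identityˡ (f n)) (sum-0*≡0 n λ i → f (n ∸ suc (toℕ i))) ⟩
  f n ℚ.+ 0ℚ
    ≡⟨ ℚ.+-identityʳ (f n) ⟩
  f n ∎

1+r-*-zero : ∀ f → (1+r * f) 0 ≡ f 0
1+r-*-zero f = trans (ℚ.+-identityʳ _) (ℚ.*-identityˡ (f 0))

1+r-*-suc : ∀ f n → (1+r * f) (suc n) ≡ f (suc n) ℚ.+ f n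
1+r-*-suc f n = cong₂ ℚ._+_ (ℚ.*-identityˡ (f (suc n))) (*-identityˡ f n)

1+r-*-assoc : ∀ f g → (1+r * f) * g ≈ 1+r * (f * g)
1+r-*-assoc f g zero = begin
  (1+r * f) 0 ℚ.* g 0 ℚ.+ 0ℚ  ≡⟨ cong (λ x → x ℚ.* g 0 ℚ.+ 0ℚ) (1+r-*-zero f) ⟩
  (f * g) 0                   ≡⟨ 1+r-*-zero (f * g) ⟨
  (1+r * (f * g)) 0           ∎
1+r-*-assoc f g (suc n) = begin
  (1+r * f) 0 ℚ.* g (suc n) ℚ.+ ℚΣ.sum {suc n} (λ i → (1+r * f) (suc (toℕ i)) ℚ.* g (n ∸ toℕ i))
    ≡⟨ cong₂ (λ x y → x ℚ.* g (suc n) ℚ.+ y) (1+r-*-zero f) (ℚΣ.sum-cong-≗ {suc n} λ i →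
         trans (cong (ℚ._* g (n ∸ toℕ i)) (1+r-*-suc f (toℕ i)))
               (ℚ.*-distribʳ-+ (g (n ∸ toℕ i)) (f (suc (toℕ i))) (f (toℕ i)))) ⟩
  f 0 ℚ.* g (suc n) ℚ.+ ℚΣ.sum {suc n} (λ i → u i ℚ.+ v i)
    ≡⟨ cong (f 0 ℚ.* g (suc n) ℚ.+_) (ℚΣ.∑-distrib-+ {suc n} u v) ⟩
  f 0 ℚ.* g (suc n) ℚ.+ (ℚΣ.sum u ℚ.+ ℚΣ.sum v)
    ≡⟨ ℚ.+-assoc (f 0 ℚ.* g (suc n)) (ℚΣ.sum u) (ℚΣ.sum v) ⟨
  (f * g) (suc n) ℚ.+ (f * g) n
    ≡⟨ 1+r-*-suc (f * g) n ⟨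
  (1+r * (f * g)) (suc n) ∎
  where
  u v : Fin (suc n) → ℚ
  u i = f (suc (toℕ i)) ℚ.* g (n ∸ toℕ i)
  v i = f (toℕ i) ℚ.* g (n ∸ toℕ i)

1+r-^-comm : ∀ n f → 1+r ^ n * (1+r * f) ≈ 1+r * (1+r ^ n * f)
1+r-^-comm zero    f = ≈-trans (*-identityˡ (1+r * f)) (*-congˡ 1+r (≈-sym (*-identityˡ f)))
1+r-^-comm (suc n) f =
  ≈-trans (1+r-*-assoc (1+r ^ n) (1+r * f))
  (≈-trans (*-congˡ 1+r (1+r-^-comm n f))
           (*-congˡ 1+r (≈-sym (1+r-*-assoc (1+r ^ n) f))))

1+r-*-[1+r]⁻¹-* : ∀ f → 1+r * ([1+r]⁻¹ * f) ≈ f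
1+r-*-[1+r]⁻¹-* f =
  ≈-trans (≈-sym (1+r-*-assoc [1+r]⁻¹ f)) (≈-trans (*-congʳ f [1+r]-inverseʳ) (*-identityˡ f))

1+r-^-inverse : ∀ n f → 1+r ^ n * ([1+r]⁻¹ ^ n * f) ≈ f
1+r-^-inverse zero    f = ≈-trans (*-identityˡ (1# * f)) (*-identityˡ f)
1+r-^-inverse (suc n) f =
  ≈-trans (1+r-*-assoc (1+r ^ n) g)
  (≈-trans (≈-sym (1+r-^-comm n g))
  (≈-trans (*-congˡ (1+r ^ n) 1+r-*-g) (1+r-^-inverse n f)))
  where
  g = [1+r]⁻¹ ^ suc n * f

  1+r-*-g : 1+r * g ≈ [1+r]⁻¹ ^ n * f
  1+r-*-g = ≈-trans (≈-sym (1+r-*-assoc ([1+r]⁻¹ ^ suc n) f)) (*-congʳ f (1+r-*-[1+r]⁻¹-* ([1+r]⁻¹ ^ n)))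

[1+r]^-neg : ∀ n → [1+r]^ (ℤ.- (+ n)) ≡ [1+r]⁻¹ ^ n
[1+r]^-neg zero    = refl
[1+r]^-neg (suc n) = refl

/1-suc : ∀ n → (+ suc n) / 1 ≡ 1ℚ ℚ.+ (+ n) / 1
/1-suc n = sym (/-homo-+ 1ℤ (+ n) 1)

∂/∂r-cong : ∀ {f g} → f ≈ g → ∂/∂r f ≈ ∂/∂r g
∂/∂r-cong p n = cong ((+ suc n / 1) ℚ.*_) (p (suc n))

∂/∂r-1+r-* : ∀ f → ∂/∂r (1+r * f) ≈ 1+r * ∂/∂r f + f
∂/∂r-1+r-* f zero = begin
  1ℚ ℚ.* (1+r * f) 1                 ≡⟨ cong (1ℚ ℚ.*_) (1+r-*-suc f 0) ⟩
  1ℚ ℚ.* (f 1 ℚ.+ f 0)               ≡⟨ solve 2 (λ x y → con 1ℚ :* (x :+ y) := con 1ℚ :* x :+ y) refl (f 1) (f 0) ⟩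
  ∂/∂r f 0 ℚ.+ f 0                   ≡⟨ cong (ℚ._+ f 0) (1+r-*-zero (∂/∂r f)) ⟨
  (1+r * ∂/∂r f) 0 ℚ.+ f 0           ∎
  where open +-*-Solver
∂/∂r-1+r-* f (suc n) = begin
  ((+ suc (suc n)) / 1) ℚ.* (1+r * f) (suc (suc n))
    ≡⟨ cong₂ ℚ._*_ (/1-suc (suc n)) (1+r-*-suc f (suc n)) ⟩
  (1ℚ ℚ.+ a) ℚ.* (x ℚ.+ y)
    ≡⟨ solve 3 (λ a x y → (con 1ℚ :+ a) :* (x :+ y) := (con 1ℚ :+ a) :* x :+ a :* y :+ y) refl a x y ⟩
  (1ℚ ℚ.+ a) ℚ.* x ℚ.+ a ℚ.* y ℚ.+ y
    ≡⟨ cong (λ c → c ℚ.* x ℚ.+ a ℚ.* y ℚ.+ y) (/1-suc (suc n)) ⟨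
  ∂/∂r f (suc n) ℚ.+ ∂/∂r f n ℚ.+ y
    ≡⟨ cong (ℚ._+ y) (1+r-*-suc (∂/∂r f) n) ⟨
  (1+r * ∂/∂r f) (suc n) ℚ.+ y ∎
  where
  open +-*-Solver
  a = (+ suc n) / 1
  x = f (suc (suc n))
  y = f (suc n)

1+r-*-distrib : ∀ b f g → 1+r * (f - (+ b) · g) ≈ 1+r * (f + g) - (+ suc b) · (1+r * g)
1+r-*-distrib b f g zero = begin
  (1+r * (f - (+ b) · g)) 0
    ≡⟨ 1+r-*-zero (f - (+ b) · g) ⟩
  f 0 ℚ.- (+ b / 1) ℚ.* g 0
    ≡⟨ solve 3 (λ β x y → x :- β :* y := x :+ y :- (con 1ℚ :+ β) :* y) refl (+ b / 1) (f 0) (g 0) ⟩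
  f 0 ℚ.+ g 0 ℚ.- (1ℚ ℚ.+ (+ b / 1)) ℚ.* g 0
    ≡⟨ cong₂ ℚ._-_ (1+r-*-zero (f + g)) (cong₂ ℚ._*_ (/1-suc b) (1+r-*-zero g)) ⟨
  (1+r * (f + g)) 0 ℚ.- (+ suc b / 1) ℚ.* (1+r * g) 0 ∎
  where open +-*-Solver
1+r-*-distrib b f g (suc n) = begin
  (1+r * (f - (+ b) · g)) (suc n)
    ≡⟨ 1+r-*-suc (f - (+ b) · g) n ⟩
  (f (suc n) ℚ.- β ℚ.* g (suc n)) ℚ.+ (f n ℚ.- β ℚ.* g n)
    ≡⟨ solve 5 (λ β x y x′ y′ → (x :- β :* y) :+ (x′ :- β :* y′)
                             := (x :+ y) :+ (x′ :+ y′) :- (con 1ℚ :+ β) :* (y :+ y′))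
         refl β (f (suc n)) (g (suc n)) (f n) (g n) ⟩
  (f + g) (suc n) ℚ.+ (f + g) n ℚ.- (1ℚ ℚ.+ β) ℚ.* (g (suc n) ℚ.+ g n)
    ≡⟨ cong₂ ℚ._-_ (1+r-*-suc (f + g) n) (cong₂ ℚ._*_ (/1-suc b) (1+r-*-suc g n)) ⟨
  (1+r * (f + g)) (suc n) ℚ.- (+ suc b / 1) ℚ.* (1+r * g) (suc n) ∎
  where
  open +-*-Solver
  β = + b / 1

1+r-^-∂/∂r : ∀ b f → 1+r ^ suc b * ∂/∂r f ≈ 1+r * ∂/∂r (1+r ^ b * f) - (+ b) · (1+r ^ b * f)
1+r-^-∂/∂r zero f n = begin
  (1+r ^ 1 * ∂/∂r f) n
    ≡⟨ 1+r-*-assoc 1# (∂/∂r f) n ⟩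
  (1+r * (1# * ∂/∂r f)) n
    ≡⟨ *-congˡ 1+r (≈-trans (*-identityˡ (∂/∂r f)) (∂/∂r-cong (≈-sym (*-identityˡ f)))) n ⟩
  (1+r * ∂/∂r (1# * f)) n
    ≡⟨ solve 2 (λ x y → x := x :- con 0ℚ :* y) refl _ ((1# * f) n) ⟩
  (1+r * ∂/∂r (1# * f)) n ℚ.- 0ℚ ℚ.* (1# * f) n ∎
  where open +-*-Solver
1+r-^-∂/∂r (suc b) f n = begin
  (1+r ^ suc (suc b) * ∂/∂r f) n
    ≡⟨ 1+r-*-assoc (1+r ^ suc b) (∂/∂r f) n ⟩
  (1+r * (1+r ^ suc b * ∂/∂r f)) n
    ≡⟨ *-congˡ 1+r (1+r-^-∂/∂r b f) n ⟩
  (1+r * (1+r * ∂/∂r g - (+ b) · g)) n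
    ≡⟨ 1+r-*-distrib b (1+r * ∂/∂r g) g n ⟩
  (1+r * (1+r * ∂/∂r g + g) - (+ suc b) · (1+r * g)) n
    ≡⟨ cong₂ ℚ._-_ (*-congˡ 1+r (≈-sym ∂/∂r-step) n) (cong ((+ suc b / 1) ℚ.*_) (sym (1+r-*-assoc (1+r ^ b) f n))) ⟩
  (1+r * ∂/∂r (1+r ^ suc b * f) - (+ suc b) · (1+r ^ suc b * f)) n ∎
  where
  g = 1+r ^ b * f

  ∂/∂r-step : ∂/∂r (1+r ^ suc b * f) ≈ 1+r * ∂/∂r g + g
  ∂/∂r-step = ≈-trans (∂/∂r-cong (1+r-*-assoc (1+r ^ b) f)) (∂/∂r-1+r-* g)

twisted-∂/∂r : ∀ b f → [1+r]^ (+ b ℤ.+ 1ℤ) * ∂/∂r ([1+r]^ (ℤ.- (+ b)) * f) ≈ 1+r * ∂/∂r f - (+ b) · f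
twisted-∂/∂r b f rewrite ℕ.+-comm b 1 | [1+r]^-neg b =
  ≈-trans (1+r-^-∂/∂r b ([1+r]⁻¹ ^ b * f))
    λ n → cong₂ ℚ._-_ (*-congˡ 1+r (∂/∂r-cong (1+r-^-inverse b f)) n)
                      (cong ((+ b / 1) ℚ.*_) (1+r-^-inverse b f n))

twisted-∂/∂r-coeff : ∀ b f n → ([1+r]^ (+ b ℤ.+ 1ℤ) * ∂/∂r ([1+r]^ (ℤ.- (+ b)) * f)) n
                             ≡ ∂/∂r f n ℚ.+ ((+ n ℤ.- + b) / 1) ℚ.* f n
twisted-∂/∂r-coeff b f n = begin
  ([1+r]^ (+ b ℤ.+ 1ℤ) * ∂/∂r ([1+r]^ (ℤ.- (+ b)) * f)) n    ≡⟨ twisted-∂/∂r b f n ⟩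
  (1+r * ∂/∂r f) n ℚ.- β ℚ.* f n                             ≡⟨ cong (ℚ._- β ℚ.* f n) (euler n) ⟩
  ∂/∂r f n ℚ.+ (+ n / 1) ℚ.* f n ℚ.- β ℚ.* f n               ≡⟨ solve 4 (λ d ν β x → d :+ ν :* x :- β :* x := d :+ (ν :- β) :* x)
                                                                  refl (∂/∂r f n) (+ n / 1) β (f n) ⟩
  ∂/∂r f n ℚ.+ ((+ n / 1) ℚ.- β) ℚ.* f n                     ≡⟨ cong (λ c → ∂/∂r f n ℚ.+ c ℚ.* f n) (/-homo-- (+ n) (+ b) 1) ⟩
  ∂/∂r f n ℚ.+ ((+ n ℤ.- + b) / 1) ℚ.* f n                   ∎
  where
  open +-*-Solver
  β = + b / 1

  euler : ∀ n → (1+r * ∂/∂r f) n ≡ ∂/∂r f n ℚ.+ (+ n / 1) ℚ.* f n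
  euler zero    = trans (1+r-*-zero (∂/∂r f)) (solve 2 (λ x y → x := x :+ con 0ℚ :* y) refl (∂/∂r f 0) (f 0))
  euler (suc n) = 1+r-*-suc (∂/∂r f) n

-- Numerators of the coefficients

numI : ℤ → ℤ → ℕ → ℤ
numI b ℓ n = ∏[ m < n ] (ℓ ℤ.^ 2 ℤ.- (b ℤ.- + m) ℤ.^ 2)

numJ : ℤ → ℕ → ℤ
numJ b n = ∏[ m < n ] ((b ℤ.- + m) ℤ.* (b ℤ.- + m ℤ.- 1ℤ))

∏-last : ∀ n (f : ℕ → ℤ) → ∏ (suc n) f ≡ ∏ n f ℤ.* f n
∏-last zero    f = trans (ℤ.*-identityʳ (f 0)) (sym (ℤ.*-identityˡ (f 0)))
∏-last (suc n) f = begin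
  f 0 ℤ.* ∏ (suc n) (λ m → f (suc m))            ≡⟨ cong (f 0 ℤ.*_) (∏-last n (λ m → f (suc m))) ⟩
  f 0 ℤ.* (∏ n (λ m → f (suc m)) ℤ.* f (suc n))  ≡⟨ ℤ.*-assoc (f 0) _ (f (suc n)) ⟨
  ∏ (suc n) f ℤ.* f (suc n)                      ∎

numI-suc : ∀ b ℓ n → numI b ℓ (suc n) ≡ numI b ℓ n ℤ.* (ℓ ℤ.^ 2 ℤ.- (b ℤ.- + n) ℤ.^ 2)
numI-suc b ℓ n = ∏-last n λ m → ℓ ℤ.^ 2 ℤ.- (b ℤ.- + m) ℤ.^ 2

numJ-suc : ∀ b n → numJ b (suc n) ≡ numJ b n ℤ.* ((b ℤ.- + n) ℤ.* (b ℤ.- + n ℤ.- 1ℤ))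
numJ-suc b n = ∏-last n λ m → (b ℤ.- + m) ℤ.* (b ℤ.- + m ℤ.- 1ℤ)

numI-1 : ∀ b q → numI b 1ℤ (suc q)
               ≡ -1ℤ ℤ.^ suc q ℤ.* numJ b q ℤ.* ((b ℤ.+ 1ℤ) ℤ.* (b ℤ.- + suc q))
numI-1 b zero    = base b
  where
  base : ∀ b → (1ℤ ℤ.- (b ℤ.- 0ℤ) ℤ.* ((b ℤ.- 0ℤ) ℤ.* 1ℤ)) ℤ.* 1ℤ ≡ -1ℤ ℤ.* ((b ℤ.+ 1ℤ) ℤ.* (b ℤ.- 1ℤ))
  base = solve-∀
numI-1 b (suc q) = begin
  numI b 1ℤ (suc (suc q))
    ≡⟨ numI-suc b 1ℤ (suc q) ⟩
  numI b 1ℤ (suc q) ℤ.* (1ℤ ℤ.- (b ℤ.- + suc q) ℤ.^ 2)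
    ≡⟨ cong (ℤ._* (1ℤ ℤ.- (b ℤ.- + suc q) ℤ.^ 2)) (numI-1 b q) ⟩
  s ℤ.* numJ b q ℤ.* ((b ℤ.+ 1ℤ) ℤ.* (b ℤ.- + suc q)) ℤ.* (1ℤ ℤ.- (b ℤ.- + suc q) ℤ.^ 2)
    ≡⟨ step b s (numJ b q) (+ q) ⟩
  -1ℤ ℤ.* s ℤ.* (numJ b q ℤ.* ((b ℤ.- + q) ℤ.* (b ℤ.- + q ℤ.- 1ℤ))) ℤ.* ((b ℤ.+ 1ℤ) ℤ.* (b ℤ.- + suc (suc q)))
    ≡⟨ cong (λ k → -1ℤ ℤ.* s ℤ.* k ℤ.* ((b ℤ.+ 1ℤ) ℤ.* (b ℤ.- + suc (suc q)))) (numJ-suc b q) ⟨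
  -1ℤ ℤ.* s ℤ.* numJ b (suc q) ℤ.* ((b ℤ.+ 1ℤ) ℤ.* (b ℤ.- + suc (suc q))) ∎
  where
  s = -1ℤ ℤ.^ suc q

  step : ∀ b s k q → s ℤ.* k ℤ.* ((b ℤ.+ 1ℤ) ℤ.* (b ℤ.- (1ℤ ℤ.+ q)))
                       ℤ.* (1ℤ ℤ.- (b ℤ.- (1ℤ ℤ.+ q)) ℤ.* ((b ℤ.- (1ℤ ℤ.+ q)) ℤ.* 1ℤ))
                   ≡ -1ℤ ℤ.* s ℤ.* (k ℤ.* ((b ℤ.- q) ℤ.* (b ℤ.- q ℤ.- 1ℤ)))
                       ℤ.* ((b ℤ.+ 1ℤ) ℤ.* (b ℤ.- (1ℤ ℤ.+ (1ℤ ℤ.+ q))))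
  step = solve-∀

numI-0 : ∀ b q → numI b 0ℤ (suc q)
               ≡ -1ℤ ℤ.^ suc q ℤ.* numJ b q ℤ.* (b ℤ.* (b ℤ.- + q))
numI-0 b zero    = base b
  where
  base : ∀ b → (0ℤ ℤ.- (b ℤ.- 0ℤ) ℤ.* ((b ℤ.- 0ℤ) ℤ.* 1ℤ)) ℤ.* 1ℤ ≡ -1ℤ ℤ.* (b ℤ.* (b ℤ.- 0ℤ))
  base = solve-∀
numI-0 b (suc q) = begin
  numI b 0ℤ (suc (suc q))
    ≡⟨ numI-suc b 0ℤ (suc q) ⟩
  numI b 0ℤ (suc q) ℤ.* (0ℤ ℤ.- (b ℤ.- + suc q) ℤ.^ 2)
    ≡⟨ cong (ℤ._* (0ℤ ℤ.- (b ℤ.- + suc q) ℤ.^ 2)) (numI-0 b q) ⟩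
  s ℤ.* numJ b q ℤ.* (b ℤ.* (b ℤ.- + q)) ℤ.* (0ℤ ℤ.- (b ℤ.- + suc q) ℤ.^ 2)
    ≡⟨ step b s (numJ b q) (+ q) ⟩
  -1ℤ ℤ.* s ℤ.* (numJ b q ℤ.* ((b ℤ.- + q) ℤ.* (b ℤ.- + q ℤ.- 1ℤ))) ℤ.* (b ℤ.* (b ℤ.- + suc q))
    ≡⟨ cong (λ k → -1ℤ ℤ.* s ℤ.* k ℤ.* (b ℤ.* (b ℤ.- + suc q))) (numJ-suc b q) ⟨
  -1ℤ ℤ.* s ℤ.* numJ b (suc q) ℤ.* (b ℤ.* (b ℤ.- + suc q)) ∎
  where
  s = -1ℤ ℤ.^ suc q

  step : ∀ b s k q → s ℤ.* k ℤ.* (b ℤ.* (b ℤ.- q))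
                       ℤ.* (0ℤ ℤ.- (b ℤ.- (1ℤ ℤ.+ q)) ℤ.* ((b ℤ.- (1ℤ ℤ.+ q)) ℤ.* 1ℤ))
                   ≡ -1ℤ ℤ.* s ℤ.* (k ℤ.* ((b ℤ.- q) ℤ.* (b ℤ.- q ℤ.- 1ℤ))) ℤ.* (b ℤ.* (b ℤ.- (1ℤ ℤ.+ q)))
  step = solve-∀

numI-shift : ∀ b ℓ n → numI b ℓ n ℤ.* ((ℓ ℤ.- b ℤ.+ + n) ℤ.* (ℓ ℤ.+ b ℤ.+ 1ℤ))
                     ≡ numI b (1ℤ ℤ.+ ℓ) n ℤ.* ((ℓ ℤ.- b) ℤ.* (1ℤ ℤ.+ ℓ ℤ.+ b ℤ.- + n))
numI-shift b ℓ zero    = base b ℓ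
  where
  base : ∀ b ℓ → 1ℤ ℤ.* ((ℓ ℤ.- b ℤ.+ 0ℤ) ℤ.* (ℓ ℤ.+ b ℤ.+ 1ℤ))
               ≡ 1ℤ ℤ.* ((ℓ ℤ.- b) ℤ.* (1ℤ ℤ.+ ℓ ℤ.+ b ℤ.- 0ℤ))
  base = solve-∀
numI-shift b ℓ (suc n) = begin
  numI b ℓ (suc n) ℤ.* ((ℓ ℤ.- b ℤ.+ + suc n) ℤ.* (ℓ ℤ.+ b ℤ.+ 1ℤ))
    ≡⟨ cong (ℤ._* ((ℓ ℤ.- b ℤ.+ + suc n) ℤ.* (ℓ ℤ.+ b ℤ.+ 1ℤ))) (numI-suc b ℓ n) ⟩
  numI b ℓ n ℤ.* (ℓ ℤ.^ 2 ℤ.- (b ℤ.- + n) ℤ.^ 2) ℤ.* ((ℓ ℤ.- b ℤ.+ + suc n) ℤ.* (ℓ ℤ.+ b ℤ.+ 1ℤ))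
    ≡⟨ factor b ℓ (+ n) (numI b ℓ n) ⟩
  numI b ℓ n ℤ.* ((ℓ ℤ.- b ℤ.+ + n) ℤ.* (ℓ ℤ.+ b ℤ.+ 1ℤ)) ℤ.* ((ℓ ℤ.+ b ℤ.- + n) ℤ.* (ℓ ℤ.- b ℤ.+ + suc n))
    ≡⟨ cong (ℤ._* ((ℓ ℤ.+ b ℤ.- + n) ℤ.* (ℓ ℤ.- b ℤ.+ + suc n))) (numI-shift b ℓ n) ⟩
  numI b (1ℤ ℤ.+ ℓ) n ℤ.* ((ℓ ℤ.- b) ℤ.* (1ℤ ℤ.+ ℓ ℤ.+ b ℤ.- + n)) ℤ.* ((ℓ ℤ.+ b ℤ.- + n) ℤ.* (ℓ ℤ.- b ℤ.+ + suc n))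
    ≡⟨ unfactor b ℓ (+ n) (numI b (1ℤ ℤ.+ ℓ) n) ⟩
  numI b (1ℤ ℤ.+ ℓ) n ℤ.* ((1ℤ ℤ.+ ℓ) ℤ.^ 2 ℤ.- (b ℤ.- + n) ℤ.^ 2)
    ℤ.* ((ℓ ℤ.- b) ℤ.* (1ℤ ℤ.+ ℓ ℤ.+ b ℤ.- + suc n))
    ≡⟨ cong (ℤ._* ((ℓ ℤ.- b) ℤ.* (1ℤ ℤ.+ ℓ ℤ.+ b ℤ.- + suc n))) (numI-suc b (1ℤ ℤ.+ ℓ) n) ⟨
  numI b (1ℤ ℤ.+ ℓ) (suc n) ℤ.* ((ℓ ℤ.- b) ℤ.* (1ℤ ℤ.+ ℓ ℤ.+ b ℤ.- + suc n)) ∎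
  where
  factor : ∀ b ℓ n p → p ℤ.* (ℓ ℤ.* (ℓ ℤ.* 1ℤ) ℤ.- (b ℤ.- n) ℤ.* ((b ℤ.- n) ℤ.* 1ℤ))
                         ℤ.* ((ℓ ℤ.- b ℤ.+ (1ℤ ℤ.+ n)) ℤ.* (ℓ ℤ.+ b ℤ.+ 1ℤ))
                     ≡ p ℤ.* ((ℓ ℤ.- b ℤ.+ n) ℤ.* (ℓ ℤ.+ b ℤ.+ 1ℤ))
                         ℤ.* ((ℓ ℤ.+ b ℤ.- n) ℤ.* (ℓ ℤ.- b ℤ.+ (1ℤ ℤ.+ n)))
  factor = solve-∀

  unfactor : ∀ b ℓ n p → p ℤ.* ((ℓ ℤ.- b) ℤ.* (1ℤ ℤ.+ ℓ ℤ.+ b ℤ.- n))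
                           ℤ.* ((ℓ ℤ.+ b ℤ.- n) ℤ.* (ℓ ℤ.- b ℤ.+ (1ℤ ℤ.+ n)))
                       ≡ p ℤ.* ((1ℤ ℤ.+ ℓ) ℤ.* ((1ℤ ℤ.+ ℓ) ℤ.* 1ℤ) ℤ.- (b ℤ.- n) ℤ.* ((b ℤ.- n) ℤ.* 1ℤ))
                           ℤ.* ((ℓ ℤ.- b) ℤ.* (1ℤ ℤ.+ ℓ ℤ.+ b ℤ.- (1ℤ ℤ.+ n)))
  unfactor = solve-∀

-- n! (n + 1)! times the n-th coefficient of (1 + r)ᵇ⁺¹ ∂/∂r ((1 + r)⁻ᵇ I(b,ℓ)) + ℓ I(b,ℓ).
telescope : ℤ → ℤ → ℕ → ℤ
telescope b ℓ n = numI b ℓ n ℤ.* ((ℓ ℤ.- b ℤ.+ + n) ℤ.* (ℓ ℤ.+ b ℤ.+ 1ℤ))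

telescope-suc : ∀ b ℓ n → telescope b (1ℤ ℤ.+ ℓ) n
              ≡ telescope b ℓ n ℤ.+ + 2 ℤ.* (1ℤ ℤ.+ ℓ) ℤ.* (numI b (1ℤ ℤ.+ ℓ) n ℤ.* + suc n)
telescope-suc b ℓ n = begin
  telescope b (1ℤ ℤ.+ ℓ) n
    ≡⟨ split b ℓ (+ n) (numI b (1ℤ ℤ.+ ℓ) n) ⟩
  numI b (1ℤ ℤ.+ ℓ) n ℤ.* ((ℓ ℤ.- b) ℤ.* (1ℤ ℤ.+ ℓ ℤ.+ b ℤ.- + n)) ℤ.+ δ
    ≡⟨ cong (ℤ._+ δ) (numI-shift b ℓ n) ⟨
  telescope b ℓ n ℤ.+ δ ∎
  where
  δ = + 2 ℤ.* (1ℤ ℤ.+ ℓ) ℤ.* (numI b (1ℤ ℤ.+ ℓ) n ℤ.* + suc n)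

  split : ∀ b ℓ n p → p ℤ.* ((1ℤ ℤ.+ ℓ ℤ.- b ℤ.+ n) ℤ.* (1ℤ ℤ.+ ℓ ℤ.+ b ℤ.+ 1ℤ))
                    ≡ p ℤ.* ((ℓ ℤ.- b) ℤ.* (1ℤ ℤ.+ ℓ ℤ.+ b ℤ.- n))
                      ℤ.+ + 2 ℤ.* (1ℤ ℤ.+ ℓ) ℤ.* (p ℤ.* (1ℤ ℤ.+ n))
  split = solve-∀

telescope-diagonal : ∀ b n → telescope b b n ≡ 0ℤ
telescope-diagonal b zero    = vanish b
  where
  vanish : ∀ b → 1ℤ ℤ.* ((b ℤ.- b ℤ.+ 0ℤ) ℤ.* (b ℤ.+ b ℤ.+ 1ℤ)) ≡ 0ℤ
  vanish = solve-∀
telescope-diagonal b (suc n) = vanish b _ _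
  where
  vanish : ∀ b p x → (b ℤ.* (b ℤ.* 1ℤ) ℤ.- (b ℤ.- 0ℤ) ℤ.* ((b ℤ.- 0ℤ) ℤ.* 1ℤ)) ℤ.* p ℤ.* x ≡ 0ℤ
  vanish = solve-∀

telescope-≡ : ∀ b ℓ n → numI b ℓ (suc n) ℤ.+ (+ n ℤ.- b) ℤ.* (numI b ℓ n ℤ.* + suc n)
                      ≡ (ℤ.- ℓ) ℤ.* (numI b ℓ n ℤ.* + suc n) ℤ.+ telescope b ℓ n
telescope-≡ b ℓ n = trans (cong (ℤ._+ (+ n ℤ.- b) ℤ.* (numI b ℓ n ℤ.* + suc n)) (numI-suc b ℓ n))
                          (expand b ℓ (+ n) (numI b ℓ n))
  where
  expand : ∀ b ℓ n p → p ℤ.* (ℓ ℤ.* (ℓ ℤ.* 1ℤ) ℤ.- (b ℤ.- n) ℤ.* ((b ℤ.- n) ℤ.* 1ℤ))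
                         ℤ.+ (n ℤ.- b) ℤ.* (p ℤ.* (1ℤ ℤ.+ n))
                     ≡ (ℤ.- ℓ) ℤ.* (p ℤ.* (1ℤ ℤ.+ n)) ℤ.+ p ℤ.* ((ℓ ℤ.- b ℤ.+ n) ℤ.* (ℓ ℤ.+ b ℤ.+ 1ℤ))
  expand = solve-∀

-- Coefficients over a common denominator

infixl 8 _/⟨_,_⟩

_/⟨_,_⟩ : ℤ → ℕ → ℕ → ℚ
i /⟨ m , n ⟩ = i / (m ! ℕ.* n !)
  where instance _ = m !* n !≢0

/⟨⟩-cross : ∀ i j m n m′ n′ → i ℤ.* + (m′ ! ℕ.* n′ !) ≡ j ℤ.* + (m ! ℕ.* n !) →
            i /⟨ m , n ⟩ ≡ j /⟨ m′ , n′ ⟩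
/⟨⟩-cross i j m n m′ n′ = /-cross i j (m ! ℕ.* n !) (m′ ! ℕ.* n′ !) {{m !* n !≢0}} {{m′ !* n′ !≢0}}

/⟨⟩-homo-+ : ∀ i j m n → i /⟨ m , n ⟩ ℚ.+ j /⟨ m , n ⟩ ≡ (i ℤ.+ j) /⟨ m , n ⟩
/⟨⟩-homo-+ i j m n = /-homo-+ i j (m ! ℕ.* n !) {{m !* n !≢0}}

/⟨⟩-homo-- : ∀ i j m n → i /⟨ m , n ⟩ ℚ.- j /⟨ m , n ⟩ ≡ (i ℤ.- j) /⟨ m , n ⟩
/⟨⟩-homo-- i j m n = /-homo-- i j (m ! ℕ.* n !) {{m !* n !≢0}}

/1-*-/⟨⟩ : ∀ i j m n → (i / 1) ℚ.* j /⟨ m , n ⟩ ≡ (i ℤ.* j) /⟨ m , n ⟩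
/1-*-/⟨⟩ i j m n = /1-*-/ i j (m ! ℕ.* n !) {{m !* n !≢0}}

!-suc-* : ∀ m n → + (suc m ! ℕ.* n) ≡ + suc m ℤ.* (+ (m ! ℕ.* n))
!-suc-* m n = trans (cong +_ (ℕ.*-assoc (suc m) (m !) n)) (pos-* (suc m) (m ! ℕ.* n))

*-!-suc : ∀ m n → + (n ℕ.* suc m !) ≡ + suc m ℤ.* (+ (n ℕ.* m !))
*-!-suc m n = trans (cong +_ (ℕ.*-comm n (suc m !)))
             (trans (!-suc-* m n) (cong (λ k → + suc m ℤ.* + k) (ℕ.*-comm (m !) n)))

∂/∂r-J : ∀ b n → ∂/∂r (J b) n ≡ (-1ℤ ℤ.^ n ℤ.* numJ b n) /⟨ n , n ⟩
∂/∂r-J b n = trans (/1-*-/⟨⟩ (+ suc n) i (suc n) n) (/⟨⟩-cross (+ suc n ℤ.* i) (s ℤ.* numJ b n) (suc n) n n n (begin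
  + suc n ℤ.* i ℤ.* d
    ≡⟨ cong (λ k → + suc n ℤ.* (-1ℤ ℤ.* -1ℤ ℤ.^ k ℤ.* numJ b n) ℤ.* d) (ℕ.+-comm n 1) ⟩
  + suc n ℤ.* (-1ℤ ℤ.* (-1ℤ ℤ.* s) ℤ.* numJ b n) ℤ.* d
    ≡⟨ move (+ suc n) s (numJ b n) d ⟩
  s ℤ.* numJ b n ℤ.* (+ suc n ℤ.* d)
    ≡⟨ cong (s ℤ.* numJ b n ℤ.*_) (!-suc-* n (n !)) ⟨
  s ℤ.* numJ b n ℤ.* + (suc n ! ℕ.* n !) ∎))
  where
  i = -1ℤ ℤ.^ (suc n ℕ.+ 1) ℤ.* numJ b n
  d = + (n ! ℕ.* n !)
  s = -1ℤ ℤ.^ n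

  move : ∀ n s k d → n ℤ.* (-1ℤ ℤ.* (-1ℤ ℤ.* s) ℤ.* k) ℤ.* d ≡ s ℤ.* k ℤ.* (n ℤ.* d)
  move = solve-∀

J-suc : ∀ b q → let n = suc q in J b n ≡ (ℤ.- (-1ℤ ℤ.^ n ℤ.* numJ b q ℤ.* + n)) /⟨ n , n ⟩
J-suc b q = /⟨⟩-cross (-1ℤ ℤ.^ (suc q ℕ.+ 1) ℤ.* numJ b q) (ℤ.- (s ℤ.* numJ b q ℤ.* + suc q)) (suc q) q (suc q) (suc q) (begin
  -1ℤ ℤ.^ (suc q ℕ.+ 1) ℤ.* numJ b q ℤ.* + (suc q ! ℕ.* suc q !)
    ≡⟨ cong₂ (λ k d → -1ℤ ℤ.^ k ℤ.* numJ b q ℤ.* d) (ℕ.+-comm (suc q) 1) (*-!-suc q (suc q !)) ⟩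
  -1ℤ ℤ.* s ℤ.* numJ b q ℤ.* (+ suc q ℤ.* + (suc q ! ℕ.* q !))
    ≡⟨ move (+ suc q) s (numJ b q) (+ (suc q ! ℕ.* q !)) ⟩
  (ℤ.- (s ℤ.* numJ b q ℤ.* + suc q)) ℤ.* + (suc q ! ℕ.* q !) ∎)
  where
  s = -1ℤ ℤ.^ suc q

  move : ∀ n s k d → -1ℤ ℤ.* s ℤ.* k ℤ.* (n ℤ.* d) ≡ (ℤ.- (s ℤ.* k ℤ.* n)) ℤ.* d
  move = solve-∀

I-/ : ∀ b ℓ n → I b ℓ n ≡ (numI b ℓ n ℤ.* + suc n) /⟨ n , suc n ⟩
I-/ b ℓ n = /⟨⟩-cross (numI b ℓ n) (numI b ℓ n ℤ.* + suc n) n n n (suc n) (begin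
  numI b ℓ n ℤ.* + (n ! ℕ.* suc n !)            ≡⟨ cong (numI b ℓ n ℤ.*_) (*-!-suc n (n !)) ⟩
  numI b ℓ n ℤ.* (+ suc n ℤ.* + (n ! ℕ.* n !))  ≡⟨ ℤ.*-assoc (numI b ℓ n) (+ suc n) _ ⟨
  numI b ℓ n ℤ.* + suc n ℤ.* + (n ! ℕ.* n !)    ∎)

∂/∂r-I : ∀ b ℓ n → ∂/∂r (I b ℓ) n ≡ numI b ℓ (suc n) /⟨ n , suc n ⟩
∂/∂r-I b ℓ n = trans (/1-*-/⟨⟩ (+ suc n) p (suc n) (suc n)) (/⟨⟩-cross (+ suc n ℤ.* p) p (suc n) (suc n) n (suc n) (begin
  + suc n ℤ.* p ℤ.* + (n ! ℕ.* suc n !)    ≡⟨ cong (ℤ._* + (n ! ℕ.* suc n !)) (ℤ.*-comm (+ suc n) p) ⟩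
  p ℤ.* + suc n ℤ.* + (n ! ℕ.* suc n !)    ≡⟨ ℤ.*-assoc p (+ suc n) _ ⟩
  p ℤ.* (+ suc n ℤ.* + (n ! ℕ.* suc n !))  ≡⟨ cong (p ℤ.*_) (!-suc-* n (suc n !)) ⟨
  p ℤ.* + (suc n ! ℕ.* suc n !)            ∎))
  where p = numI b ℓ (suc n)

I-1-≈ : ∀ b → I (+ b) 1ℤ ≈ ([1+r]^ (+ b ℤ.+ 1ℤ)) * ∂/∂r (([1+r]^ (ℤ.- (+ b))) * J (+ b))
I-1-≈ b n = trans (coeff n) (sym (twisted-∂/∂r-coeff b (J (+ b)) n))
  where
  coeff : ∀ n → I (+ b) 1ℤ n ≡ ∂/∂r (J (+ b)) n ℚ.+ ((+ n ℤ.- + b) / 1) ℚ.* J (+ b) n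
  coeff zero    = cong (1ℚ ℚ.+_) (sym (ℚ.*-zeroʳ ((0ℤ ℤ.- + b) / 1)))
  coeff n@(suc q) = begin
    numI (+ b) 1ℤ n /⟨ n , n ⟩
      ≡⟨ cong (_/⟨ n , n ⟩) (trans (numI-1 (+ b) q) (expand (+ b) s (numJ (+ b) q) (+ q))) ⟩
    (s ℤ.* (numJ (+ b) q ℤ.* ((+ b ℤ.- + q) ℤ.* (+ b ℤ.- + q ℤ.- 1ℤ))) ℤ.+ (+ n ℤ.- + b) ℤ.* j) /⟨ n , n ⟩
      ≡⟨ cong (λ k → (s ℤ.* k ℤ.+ (+ n ℤ.- + b) ℤ.* j) /⟨ n , n ⟩) (numJ-suc (+ b) q) ⟨
    (s ℤ.* numJ (+ b) n ℤ.+ (+ n ℤ.- + b) ℤ.* j) /⟨ n , n ⟩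
      ≡⟨ /⟨⟩-homo-+ (s ℤ.* numJ (+ b) n) _ n n ⟨
    (s ℤ.* numJ (+ b) n) /⟨ n , n ⟩ ℚ.+ ((+ n ℤ.- + b) ℤ.* j) /⟨ n , n ⟩
      ≡⟨ cong₂ ℚ._+_ (∂/∂r-J (+ b) n) (/1-*-/⟨⟩ (+ n ℤ.- + b) j n n) ⟨
    ∂/∂r (J (+ b)) n ℚ.+ ((+ n ℤ.- + b) / 1) ℚ.* j /⟨ n , n ⟩
      ≡⟨ cong (λ x → ∂/∂r (J (+ b)) n ℚ.+ ((+ n ℤ.- + b) / 1) ℚ.* x) (J-suc (+ b) q) ⟨
    ∂/∂r (J (+ b)) n ℚ.+ ((+ n ℤ.- + b) / 1) ℚ.* J (+ b) n ∎
    where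
    s = -1ℤ ℤ.^ n
    j = ℤ.- (s ℤ.* numJ (+ b) q ℤ.* + n)

    expand : ∀ b s k q → s ℤ.* k ℤ.* ((b ℤ.+ 1ℤ) ℤ.* (b ℤ.- (1ℤ ℤ.+ q)))
                       ≡ s ℤ.* (k ℤ.* ((b ℤ.- q) ℤ.* (b ℤ.- q ℤ.- 1ℤ)))
                         ℤ.+ ((1ℤ ℤ.+ q) ℤ.- b) ℤ.* (ℤ.- (s ℤ.* k ℤ.* (1ℤ ℤ.+ q)))
    expand = solve-∀

I-1-I-0 : ∀ b → I (+ b) 1ℤ - I (+ b) 0ℤ ≈ J (+ b)
I-1-I-0 b zero    = refl
I-1-I-0 b n@(suc q) = begin
  numI (+ b) 1ℤ n /⟨ n , n ⟩ ℚ.- numI (+ b) 0ℤ n /⟨ n , n ⟩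
    ≡⟨ /⟨⟩-homo-- (numI (+ b) 1ℤ n) (numI (+ b) 0ℤ n) n n ⟩
  (numI (+ b) 1ℤ n ℤ.- numI (+ b) 0ℤ n) /⟨ n , n ⟩
    ≡⟨ cong (_/⟨ n , n ⟩) (trans (cong₂ ℤ._-_ (numI-1 (+ b) q) (numI-0 (+ b) q)) (collect (+ b) s (numJ (+ b) q) (+ q))) ⟩
  (ℤ.- (s ℤ.* numJ (+ b) q ℤ.* + n)) /⟨ n , n ⟩
    ≡⟨ J-suc (+ b) q ⟨
  J (+ b) n ∎
  where
  s = -1ℤ ℤ.^ n

  collect : ∀ b s k q → s ℤ.* k ℤ.* ((b ℤ.+ 1ℤ) ℤ.* (b ℤ.- (1ℤ ℤ.+ q))) ℤ.- s ℤ.* k ℤ.* (b ℤ.* (b ℤ.- q))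
                      ≡ ℤ.- (s ℤ.* k ℤ.* (1ℤ ℤ.+ q))
  collect = solve-∀

sum₁-last : ∀ ℓ (f : ℕ → PowerSeries) n → sum₁ (suc ℓ) f n ≡ sum₁ ℓ f n ℚ.+ f (suc ℓ) n
sum₁-last zero    f n = ℚ.+-comm (f 1 n) 0ℚ
sum₁-last (suc ℓ) f n = begin
  f 1 n ℚ.+ sum₁ (suc ℓ) (λ k → f (suc k)) n                      ≡⟨ cong (f 1 n ℚ.+_) (sum₁-last ℓ (λ k → f (suc k)) n) ⟩
  f 1 n ℚ.+ (sum₁ ℓ (λ k → f (suc k)) n ℚ.+ f (suc (suc ℓ)) n)    ≡⟨ ℚ.+-assoc (f 1 n) _ _ ⟨
  sum₁ (suc ℓ) f n ℚ.+ f (suc (suc ℓ)) n                          ∎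

sum-2kI : ∀ b ℓ n → (∑[ 1≤ k ≤ ℓ ] ((+ (2 ℕ.* k)) · I b (+ k))) n
                  ≡ (telescope b (+ ℓ) n ℤ.- telescope b 0ℤ n) /⟨ n , suc n ⟩
sum-2kI b zero    n = sym (begin
  (telescope b 0ℤ n ℤ.- telescope b 0ℤ n) /⟨ n , suc n ⟩
    ≡⟨ cong (_/⟨ n , suc n ⟩) (ℤ.+-inverseʳ (telescope b 0ℤ n)) ⟩
  0ℤ /⟨ n , suc n ⟩
    ≡⟨ /-cross 0ℤ 0ℤ (n ! ℕ.* suc n !) 1 {{n !* suc n !≢0}} refl ⟩
  0ℚ ∎)
sum-2kI b (suc ℓ) n = begin
  (∑[ 1≤ k ≤ suc ℓ ] ((+ (2 ℕ.* k)) · I b (+ k))) n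
    ≡⟨ sum₁-last ℓ (λ k → (+ (2 ℕ.* k)) · I b (+ k)) n ⟩
  (∑[ 1≤ k ≤ ℓ ] ((+ (2 ℕ.* k)) · I b (+ k))) n ℚ.+ ((+ (2 ℕ.* suc ℓ)) / 1) ℚ.* I b (+ suc ℓ) n
    ≡⟨ cong₂ ℚ._+_ (sum-2kI b ℓ n)
         (trans (cong (((+ (2 ℕ.* suc ℓ)) / 1) ℚ.*_) (I-/ b (+ suc ℓ) n)) (/1-*-/⟨⟩ (+ (2 ℕ.* suc ℓ)) p n (suc n))) ⟩
  (t ℤ.- t₀) /⟨ n , suc n ⟩ ℚ.+ (+ (2 ℕ.* suc ℓ) ℤ.* p) /⟨ n , suc n ⟩
    ≡⟨ /⟨⟩-homo-+ (t ℤ.- t₀) _ n (suc n) ⟩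
  (t ℤ.- t₀ ℤ.+ + (2 ℕ.* suc ℓ) ℤ.* p) /⟨ n , suc n ⟩
    ≡⟨ cong (λ k → (t ℤ.- t₀ ℤ.+ k ℤ.* p) /⟨ n , suc n ⟩) (pos-* 2 (suc ℓ)) ⟩
  (t ℤ.- t₀ ℤ.+ + 2 ℤ.* + suc ℓ ℤ.* p) /⟨ n , suc n ⟩
    ≡⟨ cong (_/⟨ n , suc n ⟩) (swap t t₀ (+ 2 ℤ.* + suc ℓ ℤ.* p)) ⟩
  (t ℤ.+ + 2 ℤ.* + suc ℓ ℤ.* p ℤ.- t₀) /⟨ n , suc n ⟩
    ≡⟨ cong (λ k → (k ℤ.- t₀) /⟨ n , suc n ⟩) (telescope-suc b (+ ℓ) n) ⟨
  (telescope b (+ suc ℓ) n ℤ.- t₀) /⟨ n , suc n ⟩ ∎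
  where
  p  = numI b (+ suc ℓ) n ℤ.* + suc n
  t  = telescope b (+ ℓ) n
  t₀ = telescope b 0ℤ n

  swap : ∀ x y z → x ℤ.- y ℤ.+ z ≡ x ℤ.+ z ℤ.- y
  swap = solve-∀

twisted-∂/∂r-I : ∀ b ℓ →
  ([1+r]^ (+ b ℤ.+ 1ℤ)) * ∂/∂r (([1+r]^ (ℤ.- (+ b))) * I (+ b) (+ ℓ))
    ≈ ((ℤ.- (+ ℓ)) · I (+ b) (+ ℓ)
        + (∑[ 1≤ k ≤ ℓ ] ((+ (2 ℕ.* k)) · I (+ b) (+ k))))
        - (∑[ 1≤ k ≤ b ] ((+ (2 ℕ.* k)) · I (+ b) (+ k)))
twisted-∂/∂r-I b ℓ n = begin
  ([1+r]^ (+ b ℤ.+ 1ℤ) * ∂/∂r ([1+r]^ (ℤ.- (+ b)) * I (+ b) (+ ℓ))) n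
    ≡⟨ twisted-∂/∂r-coeff b (I (+ b) (+ ℓ)) n ⟩
  ∂/∂r (I (+ b) (+ ℓ)) n ℚ.+ ((+ n ℤ.- + b) / 1) ℚ.* I (+ b) (+ ℓ) n
    ≡⟨ cong₂ ℚ._+_ (∂/∂r-I (+ b) (+ ℓ) n) (·I (+ n ℤ.- + b)) ⟩
  numI (+ b) (+ ℓ) (suc n) /⟨ n , suc n ⟩ ℚ.+ ((+ n ℤ.- + b) ℤ.* p) /⟨ n , suc n ⟩
    ≡⟨ /⟨⟩-homo-+ (numI (+ b) (+ ℓ) (suc n)) _ n (suc n) ⟩
  (numI (+ b) (+ ℓ) (suc n) ℤ.+ (+ n ℤ.- + b) ℤ.* p) /⟨ n , suc n ⟩
    ≡⟨ cong (_/⟨ n , suc n ⟩) (telescope-≡ (+ b) (+ ℓ) n) ⟩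
  ((ℤ.- + ℓ) ℤ.* p ℤ.+ t (+ ℓ)) /⟨ n , suc n ⟩
    ≡⟨ cong (_/⟨ n , suc n ⟩) (insert ((ℤ.- + ℓ) ℤ.* p) (t (+ ℓ)) (t 0ℤ)) ⟩
  ((ℤ.- + ℓ) ℤ.* p ℤ.+ (t (+ ℓ) ℤ.- t 0ℤ) ℤ.- (0ℤ ℤ.- t 0ℤ)) /⟨ n , suc n ⟩
    ≡⟨ cong (λ k → ((ℤ.- + ℓ) ℤ.* p ℤ.+ (t (+ ℓ) ℤ.- t 0ℤ) ℤ.- (k ℤ.- t 0ℤ)) /⟨ n , suc n ⟩) (telescope-diagonal (+ b) n) ⟨
  ((ℤ.- + ℓ) ℤ.* p ℤ.+ (t (+ ℓ) ℤ.- t 0ℤ) ℤ.- (t (+ b) ℤ.- t 0ℤ)) /⟨ n , suc n ⟩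
    ≡⟨ /⟨⟩-homo-- ((ℤ.- + ℓ) ℤ.* p ℤ.+ (t (+ ℓ) ℤ.- t 0ℤ)) (t (+ b) ℤ.- t 0ℤ) n (suc n) ⟨
  ((ℤ.- + ℓ) ℤ.* p ℤ.+ (t (+ ℓ) ℤ.- t 0ℤ)) /⟨ n , suc n ⟩ ℚ.- (t (+ b) ℤ.- t 0ℤ) /⟨ n , suc n ⟩
    ≡⟨ cong (ℚ._- (t (+ b) ℤ.- t 0ℤ) /⟨ n , suc n ⟩) (/⟨⟩-homo-+ ((ℤ.- + ℓ) ℤ.* p) _ n (suc n)) ⟨
  ((ℤ.- + ℓ) ℤ.* p) /⟨ n , suc n ⟩ ℚ.+ (t (+ ℓ) ℤ.- t 0ℤ) /⟨ n , suc n ⟩ ℚ.- (t (+ b) ℤ.- t 0ℤ) /⟨ n , suc n ⟩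
    ≡⟨ cong₂ ℚ._-_ (cong₂ ℚ._+_ (·I (ℤ.- + ℓ)) (sum-2kI (+ b) ℓ n)) (sum-2kI (+ b) b n) ⟨
  (((ℤ.- (+ ℓ)) · I (+ b) (+ ℓ)
        + (∑[ 1≤ k ≤ ℓ ] ((+ (2 ℕ.* k)) · I (+ b) (+ k))))
        - (∑[ 1≤ k ≤ b ] ((+ (2 ℕ.* k)) · I (+ b) (+ k)))) n ∎
  where
  p = numI (+ b) (+ ℓ) n ℤ.* + suc n

  t : ℤ → ℤ
  t k = telescope (+ b) k n

  ·I : ∀ c → (c / 1) ℚ.* I (+ b) (+ ℓ) n ≡ (c ℤ.* p) /⟨ n , suc n ⟩
  ·I c = trans (cong ((c / 1) ℚ.*_) (I-/ (+ b) (+ ℓ) n)) (/1-*-/⟨⟩ c p n (suc n))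

  insert : ∀ x y z → x ℤ.+ y ≡ x ℤ.+ (y ℤ.- z) ℤ.- (0ℤ ℤ.- z)
  insert = solve-∀

lemma17 : (∀ (b : ℕ) →
    I (+ b) 1ℤ ≈ ([1+r]^ (+ b ℤ.+ 1ℤ)) * ∂/∂r (([1+r]^ (ℤ.- (+ b))) * J (+ b)))
    × (∀ (b : ℕ) →
    I (+ b) 1ℤ - I (+ b) 0ℤ ≈ J (+ b))
    × (∀ (b ℓ : ℕ) →
    ([1+r]^ (+ b ℤ.+ 1ℤ)) * ∂/∂r (([1+r]^ (ℤ.- (+ b))) * I (+ b) (+ ℓ))
    ≈ ((ℤ.- (+ ℓ)) · I (+ b) (+ ℓ)
    + (∑[ 1≤ k ≤ ℓ ] ((+ (2 ℕ.* k)) · I (+ b) (+ k))))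
    - (∑[ 1≤ k ≤ b ] ((+ (2 ℕ.* k)) · I (+ b) (+ k))))
lemma17 = I-1-≈ , I-1-I-0 , twisted-∂/∂r-I
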